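{- Let $(b_n)_{n\ge 2}$ be any sequence with $b_n\in\mathbb{Q}$ for all $n\ge 2$. Then there exists a compatible family $F=(F_n)_{n\ge 1}$ such that $\deg F_n\le 2$ (total degree) for all $n\ge 1$ and $$F_{n-1}(\alpha_{1,n},\dots,\alpha_{n-1,n})=b_n\qquad\text{for all } n\ge 2.$$ In particular, value-level $G_n$-invariance does not imply summability at cosine points, even among compatible families of uniformly bounded total degree; that is, there exists a compatible family of uniformly bounded total degree which is value-level $G_n$-invariant at every level $n\ge 2$ but is not summable at cosine points.
   Context: For $n\ge 2$ let $\omega_n=e^{2\pi i/n}$, $G_n=\mathrm{Gal}(\mathbb{Q}(\omega_n)/\mathbb{Q})$, and $\alpha_{k,n}=\cos(2\pi k/n)\in\mathbb{Q}(\omega_n)$ for $1\le k\le n-1$. A compatible family is a sequence $F=(F_n)_{n\ge 1}$ with $F_n\in\mathbb{Q}[x_1,\dots,x_n]$ and $F_n(x_1,\dots,x_n)=F_{n+1}(x_1,\dots,x_n,0)$ for all $n\ge 1$. For $n\ge 2$ its cosine-point evaluation is $a_F(n)=F_{n-1}(\alpha_{1,n},\dots,\alpha_{n-1,n})$. $F$ is value-level $G_n$-invariant at level $n$ if $a_F(n)$ is fixed by $G_n$, equivalently $a_F(n)\in\mathbb{Q}$. $F$ is summable at cosine points if there exist an integer $N\ge 2$ and a rational function $R(n)\in\mathbb{Q}(n)$, defined at every integer $n\ge N$, such that $a_F(n)=R(n)$ for all integers $n\ge N$. -}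

module Defs where

open import Algebra.Apartness.Bundles using (HeytingCommutativeRing; HeytingField)
open import Algebra.Bundles using (CommutativeRing)
open import Algebra.Bundles.Raw using (RawSemiring; RawRing)
import Algebra.Definitions.RawSemiring as RawSemiringDefs
open import Algebra.Morphism.Structures using (IsRingMonomorphism; IsRingIsomorphism)
open import Data.Bool.Base using (if_then_else_)
open import Data.Fin.Base using (Fin; toℕ)
open import Data.Integer.Base using (+_)
open import Data.List.Base using (List; []; _∷_; map)
open import Data.Nat.Base as ℕ using (ℕ; suc; _∸_; _≤_; _<_)
import Data.Nat.Properties as ℕ
open import Data.Product.Base using (Σ-syntax; ∃-syntax; _×_; _,_)
open import Data.Rational.Base as ℚ using (ℚ; 0ℚ; ½; ≢-nonZero)
open import Data.Vec.Base using (Vec; lookup; init; last; sum)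
open import Data.Vec.Properties using (≡-dec)
open import Level using (Level; _⊔_) renaming (suc to lsuc)
open import Relation.Binary.PropositionalEquality using (_≡_; _≢_)
open import Relation.Nullary using (¬_; does)

private
  variable
    a c ℓ ℓ₁ ℓ₂ : Level
    k n : ℕ

-- A formal sum of terms c · x₁^e₁ ⋯ xₙ^eₙ.  The same monomial may occur
-- several times, so polynomials are compared through their coefficients.

Polynomial : ℕ → Set
Polynomial n = List (ℚ × Vec ℕ n)

coeff : Polynomial n → Vec ℕ n → ℚ
coeff []            m = 0ℚ
coeff ((q , e) ∷ p) m =
  (if does (≡-dec ℕ._≟_ e m) then q else 0ℚ) ℚ.+ coeff p m

infix 4 _≋_

_≋_ : Polynomial n → Polynomial n → Set
p ≋ q = ∀ m → coeff p m ≡ coeff q m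

TotalDegree≤ : ℕ → Polynomial n → Set
TotalDegree≤ d p = ∀ m → coeff p m ≢ 0ℚ → sum m ≤ d

-- p(x₁,…,xₙ,0): a term not involving xₙ₊₁ survives because 0 ^ 0 = 1.

substLast0 : Polynomial (suc n) → Polynomial n
substLast0 = map λ (q , e) → q ℚ.* (0ℚ ^ last e) , init e
  where open RawSemiringDefs ℚ.+-*-rawSemiring using (_^_)

evaluate : (R : RawSemiring a ℓ) → let open RawSemiring R in
           (ℚ → Carrier) → Polynomial n → (Fin n → Carrier) → Carrier
evaluate R ι []            x = RawSemiring.0# R
evaluate R ι ((q , e) ∷ p) x =
  ι q * product (λ i → x i ^ lookup e i) + evaluate R ι p x
  where
  open RawSemiring R using (_+_; _*_)
  open RawSemiringDefs R using (_^_; product)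

record RationalFunction : Set where
  field
    num den : Polynomial 1
    den≢0   : ¬ (den ≋ [])

evalℚ : Polynomial 1 → ℚ → ℚ
evalℚ p q = evaluate ℚ.+-*-rawSemiring (λ r → r) p (λ _ → q)

fromℕ : ℕ → ℚ
fromℕ n = + n ℚ./ 1

-- The fraction need not be reduced.  Under an existential quantifier over
-- rational functions this is immaterial: in lowest terms the denominator
-- divides the given one, so it vanishes at no further points.

DefinedAt : RationalFunction → ℕ → Set
DefinedAt R n = evalℚ (RationalFunction.den R) (fromℕ n) ≢ 0ℚ

valueAt : (R : RationalFunction) (n : ℕ) → DefinedAt R n → ℚ
valueAt R n d =
  ℚ._÷_ (evalℚ num (fromℕ n)) (evalℚ den (fromℕ n)) {{≢-nonZero d}}
  where open RationalFunction R

-- A field extension of ℚ generated by a primitive n-th root of unity ω.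
-- These data determine ℚ(e^{2πi/n}) with ω = e^{2πi/n} up to isomorphism
-- (Φₙ is irreducible over ℚ); the standard library has no complex numbers
-- in which to single out the exponential.  Equality in ℚ(ωₙ) is decidable,
-- so there the apartness x # y can be taken to be ¬ (x ≈ y).

record CyclotomicField c ℓ₁ ℓ₂ (n : ℕ) : Set (lsuc (c ⊔ ℓ₁ ⊔ ℓ₂)) where
  field
    heytingField : HeytingField c ℓ₁ ℓ₂

  open HeytingField heytingField public
    using (Carrier; _≈_; _#_; _+_; _*_; -_; 0#; 1#; heytingCommutativeRing)

  commutativeRing : CommutativeRing c ℓ₁
  commutativeRing =
    HeytingCommutativeRing.commutativeRing heytingCommutativeRing

  open CommutativeRing commutativeRing public using (rawRing)
  open RawRing rawRing public using (rawSemiring)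
  open RawSemiringDefs rawSemiring public using (_^_)

  field
    ι                  : ℚ → Carrier
    ι-isMonomorphism   : IsRingMonomorphism ℚ.+-*-rawRing rawRing ι
    ω                  : Carrier
    ω^n≈1              : ω ^ n ≈ 1#
    ω-primitive        : ∀ j → 0 < j → j < n → ¬ (ω ^ j ≈ 1#)

  polynomialAtω : Polynomial 1 → Carrier
  polynomialAtω p = evaluate rawSemiring ι p (λ _ → ω)

  field
    generated : ∀ x → ∃[ p ] ∃[ q ]
      polynomialAtω q # 0# × x * polynomialAtω q ≈ polynomialAtω p

  -- cos(2πj/n) = (ω^j + ω^{-j}) / 2 for j ≤ n, since ω^{-j} = ω^{n-j}.

  cosine : ℕ → Carrier
  cosine j = ι ½ * (ω ^ j + ω ^ (n ∸ j))

  record GaloisAutomorphism : Set (c ⊔ ℓ₁) where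
    field
      σ                 : Carrier → Carrier
      isRingIsomorphism : IsRingIsomorphism rawRing rawRing σ
      fixesℚ            : ∀ q → σ (ι q) ≈ ι q

  GaloisFixed : Carrier → Set (c ⊔ ℓ₁)
  GaloisFixed x = ∀ (g : GaloisAutomorphism) → GaloisAutomorphism.σ g x ≈ x

-- The sequence (Fₙ)ₙ≥₁ is indexed from 0: F k stands for F_{k+1}.

record CompatibleFamily : Set where
  field
    F          : ∀ k → Polynomial (suc k)
    compatible : ∀ k → F k ≋ substLast0 (F (suc k))

  AllDegrees≤ : ℕ → Set
  AllDegrees≤ d = ∀ k → TotalDegree≤ d (F k)

-- Levels n ≥ 2 are written n = 2 + k.  Then F_{n-1} is F k, with k + 1
-- variables, and i : Fin (k + 1) picks the point α_{i+1,n}.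

cosineValue : (K : CyclotomicField c ℓ₁ ℓ₂ (2 ℕ.+ k)) →
              CompatibleFamily → CyclotomicField.Carrier K
cosineValue {k = k} K 𝓕 =
  evaluate rawSemiring ι (F k) (λ i → cosine (suc (toℕ i)))
  where
  open CyclotomicField K
  open CompatibleFamily 𝓕

ValueLevelInvariant : CyclotomicField c ℓ₁ ℓ₂ (2 ℕ.+ k) →
                      CompatibleFamily → Set (c ⊔ ℓ₁)
ValueLevelInvariant K 𝓕 = CyclotomicField.GaloisFixed K (cosineValue K 𝓕)

SummableAtCosinePoints : (∀ k → CyclotomicField c ℓ₁ ℓ₂ (2 ℕ.+ k)) →
                         CompatibleFamily → Set ℓ₁
SummableAtCosinePoints K 𝓕 =
  ∃[ N ] 2 ≤ N × (Σ[ R ∈ RationalFunction ]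
    Σ[ defined ∈ (∀ n → N ≤ n → DefinedAt R n) ]
      (∀ k (N≤n : N ≤ 2 ℕ.+ k) → let open CyclotomicField (K k) in
        cosineValue (K k) 𝓕 ≈ ι (valueAt R (2 ℕ.+ k) (defined (2 ℕ.+ k) N≤n))))

-- Each x_{n-1}-divisible increment F_{n-1} - F_{n-2} is taken to be x_{n-1}
-- times an affine polynomial r.  The rational span of the cosines
-- α_{0,n}, …, α_{n-1,n} is closed under multiplication, and it contains
-- 1/α_{n-1,n} = 1/cos(2π/n) as soon as ω² ≠ -1, that is n ≠ 4.  Hence r can be
-- chosen so that r(α) = (bₙ - F_{n-2}(α)) / α_{n-1,n}.  Only n = 4 has to be
-- prepared in advance, by the choice of F₂.
--
-- For bₙ = n mod 2 a rational function agreeing with bₙ for large n would have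
-- a numerator with infinitely many roots, so it could not take the value 1.
module Submission where

open import Defs
open import Algebra.Bundles using (CommutativeRing; CommutativeSemiring)
open import Algebra.Apartness.Bundles using (HeytingField)
import Algebra.Apartness.Properties.HeytingCommutativeRing as HeytingProperties
import Algebra.Definitions.RawSemiring as RawSemiringDefs
open import Algebra.Morphism.Structures using (IsRingMonomorphism; IsRingIsomorphism)
import Algebra.Properties.CommutativeSemiring.Exp as Exp
import Algebra.Properties.Group as GroupProperties
import Algebra.Solver.Ring
open import Algebra.Solver.Ring.AlmostCommutativeRing
  using (fromCommutativeRing; _-Raw-AlmostCommutative⟶_; Induced-equivalence)
open import Data.Bool.Base using (if_then_else_)
open import Data.Fin.Base using (Fin; zero; suc; toℕ; fromℕ<) renaming (fromℕ to maxFin)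
import Data.Fin.Properties as Fin
open import Data.Integer.Base as ℤ using (+_)
import Data.Integer.Properties as ℤ
open import Data.List.Base using ([]; _∷_; map; _++_)
open import Data.List.Properties using (map-++)
open import Data.List.Relation.Unary.All as All using (All; []; _∷_)
import Data.List.Relation.Unary.All.Properties as All
import Data.Maybe.Base as Maybe
open import Data.Nat.Base as ℕ using (ℕ; zero; suc; _≤_; _<_; s≤s; z≤n; _∸_)
open import Data.Nat.Coprimality using (1-coprimeTo) renaming (sym to coprime-sym)
open import Data.Nat.DivMod using (_%_; _/_; m≡m%n+[m/n]*n; m%n<n)
import Data.Nat.Properties as ℕ
open import Data.Product.Base using (Σ-syntax; ∃-syntax; _×_; _,_; proj₁; proj₂)
open import Data.Rational.Base as ℚ using (ℚ; mkℚ; 0ℚ; 1ℚ; ½; -½; ↥_; ≢-nonZero)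
import Data.Rational.Properties as ℚ
import Data.Rational.Solver as ℚSolver
open import Data.Vec.Base using (Vec; []; _∷_; _∷ʳ_; init; last; lookup; replicate; sum; updateAt)
open import Data.Vec.Properties using (≡-dec; init-∷ʳ; last-∷ʳ)
open import Function.Base using (_∘_)
open import Level using (Level; _⊔_)
open import Relation.Binary.Definitions using (WeaklyDecidable)
open import Relation.Binary.PropositionalEquality as ≡ using (_≡_; _≢_)
open import Relation.Nullary using (¬_; does; yes; no; contradiction)
open import Relation.Nullary.Decidable using (dec⇒maybe)

open RawSemiringDefs ℚ.+-*-rawSemiring using () renaming (_^_ to _^ℚ_)

-- Formal polynomials: degree bounds and extension by one variable.

module FormalPolynomials where

  open ≡ using (refl; sym; trans; cong; cong₂; subst)

  infixl 7 _·var_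

  _·var_ : ∀ {n} → Polynomial n → Fin n → Polynomial n
  p ·var i = map (λ (q , e) → q , updateAt e i suc) p

  scale : ∀ {n} → ℚ → Polynomial n → Polynomial n
  scale r = map λ (q , e) → r ℚ.* q , e

  addVariable : ∀ {n} → Polynomial n → Polynomial (suc n)
  addVariable = map λ (q , e) → q , e ∷ʳ 0

  -- Bounds every listed term, even terms that cancel, so that it passes through `map` and `++` with
  -- no computation of coefficients.
  Exponents≤ : ∀ {n} → ℕ → Polynomial n → Set
  Exponents≤ d = All λ (_ , e) → sum e ≤ d

  Exponents≤⇒TotalDegree≤ : ∀ {n d} {p : Polynomial n} → Exponents≤ d p → TotalDegree≤ d p
  Exponents≤⇒TotalDegree≤ [] m c≢0 = contradiction refl c≢0
  Exponents≤⇒TotalDegree≤ {p = (q , e) ∷ p} (e≤d ∷ p≤d) m c≢0 with ≡-dec ℕ._≟_ e m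
  ... | yes refl = e≤d
  ... | no  _    = Exponents≤⇒TotalDegree≤ p≤d m (c≢0 ∘ trans (ℚ.+-identityˡ _))

  sum-updateAt-suc : ∀ {n} (e : Vec ℕ n) i → sum (updateAt e i suc) ≡ suc (sum e)
  sum-updateAt-suc (k ∷ e) zero    = refl
  sum-updateAt-suc (k ∷ e) (suc i) =
    trans (cong (k ℕ.+_) (sum-updateAt-suc e i)) (ℕ.+-suc k (sum e))

  sum-∷ʳ0 : ∀ {n} (e : Vec ℕ n) → sum (e ∷ʳ 0) ≡ sum e
  sum-∷ʳ0 []      = refl
  sum-∷ʳ0 (k ∷ e) = cong (k ℕ.+_) (sum-∷ʳ0 e)

  sum-replicate0 : ∀ n → sum (replicate n 0) ≡ 0
  sum-replicate0 zero    = refl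
  sum-replicate0 (suc n) = sum-replicate0 n

  Exponents≤-·var : ∀ {n d} {p : Polynomial n} i → Exponents≤ d p → Exponents≤ (suc d) (p ·var i)
  Exponents≤-·var i = All.map⁺ ∘ All.map λ {(_ , e)} e≤d →
    subst (_≤ _) (sym (sum-updateAt-suc e i)) (s≤s e≤d)

  Exponents≤-scale : ∀ {n d} {p : Polynomial n} r → Exponents≤ d p → Exponents≤ d (scale r p)
  Exponents≤-scale r = All.map⁺

  Exponents≤-addVariable : ∀ {n d} {p : Polynomial n} →
    Exponents≤ d p → Exponents≤ d (addVariable p)
  Exponents≤-addVariable = All.map⁺ ∘ All.map λ {(_ , e)} → subst (_≤ _) (sym (sum-∷ʳ0 e))

  last-updateAt-suc : ∀ {n} (e : Vec ℕ (suc n)) → last (updateAt e (maxFin n) suc) ≡ suc (last e)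
  last-updateAt-suc {zero}  (k ∷ []) = refl
  last-updateAt-suc {suc n} (k ∷ e)  = last-updateAt-suc e

  coeff-++ : ∀ {n} (p q : Polynomial n) m → coeff (p ++ q) m ≡ coeff p m ℚ.+ coeff q m
  coeff-++ []      q m = sym (ℚ.+-identityˡ _)
  coeff-++ ((r , e) ∷ p) q m =
    trans (cong (c ℚ.+_) (coeff-++ p q m)) (sym (ℚ.+-assoc c (coeff p m) (coeff q m)))
    where c = if does (≡-dec ℕ._≟_ e m) then r else 0ℚ

  substLast0-addVariable : ∀ {n} (p : Polynomial n) → substLast0 (addVariable p) ≡ p
  substLast0-addVariable []            = refl
  substLast0-addVariable ((q , e) ∷ p) = cong₂ _∷_
    (cong₂ _,_ (trans (cong (λ k → q ℚ.* (0ℚ ^ℚ k)) (last-∷ʳ 0 e)) (ℚ.*-identityʳ q)) (init-∷ʳ 0 e))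
    (substLast0-addVariable p)

  -- Every term carries a positive power of the last variable, so its coefficient picks up a factor
  -- 0. The terms stay in the list with coefficient 0, hence `≋ []` instead of equality of lists.
  substLast0-·var : ∀ {n} (p : Polynomial (suc n)) → substLast0 (p ·var maxFin n) ≋ []
  substLast0-·var []            m = refl
  substLast0-·var ((q , e) ∷ p) m
    rewrite last-updateAt-suc e
          | ℚ.*-zeroˡ (0ℚ ^ℚ last e)
          | ℚ.*-zeroʳ q
          | substLast0-·var p m
    with ≡-dec ℕ._≟_ (init (updateAt e (maxFin _) suc)) m
  ... | yes _ = refl
  ... | no  _ = refl

  -- The shape of each new member of the family. It is compatible with `p` for every `r`, so `r`
  -- stays free for adjusting the value at the new level.
  extend : ∀ {n} → Polynomial n → Polynomial (suc n) → Polynomial (suc n)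
  extend {n} p r = addVariable p ++ r ·var maxFin n

  extend-compatible : ∀ {n} (p : Polynomial n) r → p ≋ substLast0 (extend p r)
  extend-compatible {n} p r m = sym (begin
    coeff (substLast0 (addVariable p ++ r·x)) m
      ≡⟨ cong (λ s → coeff s m) (map-++ _ (addVariable p) r·x) ⟩
    coeff (substLast0 (addVariable p) ++ substLast0 r·x) m
      ≡⟨ coeff-++ (substLast0 (addVariable p)) (substLast0 r·x) m ⟩
    coeff (substLast0 (addVariable p)) m ℚ.+ coeff (substLast0 r·x) m
      ≡⟨ cong₂ ℚ._+_ (cong (λ s → coeff s m) (substLast0-addVariable p)) (substLast0-·var r m) ⟩
    coeff p m ℚ.+ 0ℚ
      ≡⟨ ℚ.+-identityʳ _ ⟩
    coeff p m ∎)
    where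
    open ≡.≡-Reasoning
    r·x = r ·var maxFin n

  Exponents≤-extend : ∀ {n} {p : Polynomial n} {r} →
    Exponents≤ 2 p → Exponents≤ 1 r → Exponents≤ 2 (extend p r)
  Exponents≤-extend p≤2 r≤1 = All.++⁺ (Exponents≤-addVariable p≤2) (Exponents≤-·var _ r≤1)

open FormalPolynomials

-- Evaluation of polynomials in a commutative semiring.

module Evaluation {a ℓ} (S : CommutativeSemiring a ℓ) (ι : ℚ → CommutativeSemiring.Carrier S)
                  {n} (x : Fin n → CommutativeSemiring.Carrier S) where

  open CommutativeSemiring S hiding (zero)
  open import Algebra.Properties.CommutativeSemigroup *-commutativeSemigroup using (x∙yz≈y∙xz)
  open import Relation.Binary.Reasoning.Setoid setoid
  open RawSemiringDefs rawSemiring using (_^_; product)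

  eval : Polynomial n → Carrier
  eval p = evaluate rawSemiring ι p x

  monomial : ∀ {n} → (Fin n → Carrier) → Vec ℕ n → Carrier
  monomial x e = product λ i → x i ^ lookup e i

  monomial-0 : ∀ {n} (x : Fin n → Carrier) → monomial x (replicate n 0) ≈ 1#
  monomial-0 {zero}  x = refl
  monomial-0 {suc n} x = trans (*-identityˡ _) (monomial-0 (x ∘ suc))

  monomial-updateAt-suc : ∀ {n} (x : Fin n → Carrier) e i →
    monomial x (updateAt e i suc) ≈ x i * monomial x e
  monomial-updateAt-suc x (k ∷ e) zero    = *-assoc _ _ _
  monomial-updateAt-suc x (k ∷ e) (suc i) = begin
    x zero ^ k * monomial (x ∘ suc) (updateAt e i suc)  ≈⟨ *-congˡ (monomial-updateAt-suc (x ∘ suc) e i) ⟩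
    x zero ^ k * (x (suc i) * monomial (x ∘ suc) e)     ≈⟨ x∙yz≈y∙xz _ _ _ ⟩
    x (suc i) * (x zero ^ k * monomial (x ∘ suc) e)     ∎

  eval-++ : ∀ p q → eval (p ++ q) ≈ eval p + eval q
  eval-++ []      q = sym (+-identityˡ _)
  eval-++ (t ∷ p) q =
    trans (+-congˡ (eval-++ p q)) (sym (+-assoc _ _ _))

  eval-·var : ∀ p i → eval (p ·var i) ≈ x i * eval p
  eval-·var []            i = sym (zeroʳ _)
  eval-·var ((q , e) ∷ p) i = begin
    ι q * monomial x (updateAt e i suc) + eval (p ·var i)
      ≈⟨ +-cong (*-congˡ (monomial-updateAt-suc x e i)) (eval-·var p i) ⟩
    ι q * (x i * monomial x e) + x i * eval p
      ≈⟨ +-congʳ (x∙yz≈y∙xz _ _ _) ⟩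
    x i * (ι q * monomial x e) + x i * eval p
      ≈⟨ distribˡ _ _ _ ⟨
    x i * eval ((q , e) ∷ p) ∎

  eval-scale : (∀ r q → ι (r ℚ.* q) ≈ ι r * ι q) →
    ∀ r p → eval (scale r p) ≈ ι r * eval p
  eval-scale ι-homo r []            = sym (zeroʳ _)
  eval-scale ι-homo r ((q , e) ∷ p) = begin
    ι (r ℚ.* q) * monomial x e + eval (scale r p)
      ≈⟨ +-cong (*-congʳ (ι-homo r q)) (eval-scale ι-homo r p) ⟩
    ι r * ι q * monomial x e + ι r * eval p
      ≈⟨ +-congʳ (*-assoc _ _ _) ⟩
    ι r * (ι q * monomial x e) + ι r * eval p
      ≈⟨ distribˡ _ _ _ ⟨
    ι r * eval ((q , e) ∷ p) ∎

-- Polynomial functions with infinitely many roots, and parity as a non-rational function.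

module RationalFunctions where

  open ≡ using (refl; sym; trans; cong; cong₂; subst)

  -- The division in `fromℕ` normalises by a gcd, which is stuck on a variable `n`; the explicit
  -- form has a numerator that can be read off.
  fromℕ-mkℚ : ∀ n → fromℕ n ≡ mkℚ (+ n) 0 (coprime-sym (1-coprimeTo n))
  fromℕ-mkℚ n = ℚ.normalize-coprime (coprime-sym (1-coprimeTo n))

  fromℕ-injective : ∀ {m n} → fromℕ m ≡ fromℕ n → m ≡ n
  fromℕ-injective {m} {n} eq =
    ℤ.+-injective (cong ↥_ (trans (sym (fromℕ-mkℚ m)) (trans eq (fromℕ-mkℚ n))))

  fromℕ-suc : ∀ n → fromℕ (suc n) ≡ 1ℚ ℚ.+ fromℕ n
  fromℕ-suc n = sym (trans (cong (1ℚ ℚ.+_) (fromℕ-mkℚ n))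
    (cong (λ k → k ℚ./ 1) (cong (ℤ._+_ (+ 1)) (ℤ.*-identityʳ (+ n)))))

  *-cancelˡ-0 : ∀ {p q} → p ≢ 0ℚ → p ℚ.* q ≡ 0ℚ → q ≡ 0ℚ
  *-cancelˡ-0 {p} {q} p≢0 pq≡0 = begin
    q                      ≡⟨ ℚ.*-identityˡ q ⟨
    1ℚ ℚ.* q               ≡⟨ cong (ℚ._* q) (ℚ.*-inverseˡ p) ⟨
    ℚ.1/ p ℚ.* p ℚ.* q     ≡⟨ ℚ.*-assoc (ℚ.1/ p) p q ⟩
    ℚ.1/ p ℚ.* (p ℚ.* q)   ≡⟨ cong (ℚ.1/ p ℚ.*_) pq≡0 ⟩
    ℚ.1/ p ℚ.* 0ℚ          ≡⟨ ℚ.*-zeroʳ (ℚ.1/ p) ⟩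
    0ℚ                     ∎
    where
    open ≡.≡-Reasoning
    instance _ = ≢-nonZero p≢0

  -- Polynomial functions, by iterated division by x − a: the quotient has
  -- smaller degree.
  Degree< : ℕ → (ℚ → ℚ) → Set
  Degree< zero    f = ∀ x → f x ≡ 0ℚ
  Degree< (suc d) f = ∀ a → ∃[ g ] Degree< d g × (∀ x → f x ≡ f a ℚ.+ (x ℚ.- a) ℚ.* g x)

  Degree<-suc : ∀ d {f} → Degree< d f → Degree< (suc d) f
  Degree<-suc zero {f} f≡0 a = (λ _ → 0ℚ) , (λ _ → refl) , λ x → begin
    f x                            ≡⟨ f≡0 x ⟩
    0ℚ                             ≡⟨ f≡0 a ⟨
    f a                            ≡⟨ solve 2 (λ y x → y := y :+ x :* con 0ℚ) refl (f a) (x ℚ.- a) ⟩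
    f a ℚ.+ (x ℚ.- a) ℚ.* 0ℚ       ∎
    where
    open ≡.≡-Reasoning
    open ℚSolver.+-*-Solver
  Degree<-suc (suc d) D a = let g , E , eq = D a in g , Degree<-suc d E , eq

  Degree<-+ˡ : ∀ c {d f} → Degree< d f → Degree< (c ℕ.+ d) f
  Degree<-+ˡ zero    D = D
  Degree<-+ˡ (suc c) D = Degree<-suc _ (Degree<-+ˡ c D)

  Degree<-0 : ∀ d → Degree< d λ _ → 0ℚ
  Degree<-0 zero    _ = refl
  Degree<-0 (suc d)   = Degree<-suc d (Degree<-0 d)

  Degree<-const : ∀ d q → Degree< (suc d) λ _ → q
  Degree<-const d q a =
    _ , Degree<-0 d , λ x → solve 2 (λ q s → q := q :+ s :* con 0ℚ) refl q (x ℚ.- a)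
    where open ℚSolver.+-*-Solver

  Degree<-cong : ∀ d {f g} → (∀ x → g x ≡ f x) → Degree< d f → Degree< d g
  Degree<-cong zero    g≗f D x = trans (g≗f x) (D x)
  Degree<-cong (suc d) g≗f D a =
    let h , E , eq = D a
    in h , E , λ x → trans (g≗f x) (trans (eq x) (cong (ℚ._+ _) (sym (g≗f a))))

  Degree<-+ : ∀ d {f g} → Degree< d f → Degree< d g → Degree< d λ x → f x ℚ.+ g x
  Degree<-+ zero    D E x = cong₂ ℚ._+_ (D x) (E x)
  Degree<-+ (suc d) {f} {g} D E a =
    let f′ , D′ , f≡ = D a
        g′ , E′ , g≡ = E a
    in _ , Degree<-+ d D′ E′ , λ x → trans (cong₂ ℚ._+_ (f≡ x) (g≡ x))
         (solve 5 (λ y u z v s → y :+ s :* u :+ (z :+ s :* v) := y :+ z :+ s :* (u :+ v))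
            refl (f a) (f′ x) (g a) (g′ x) (x ℚ.- a))
    where open ℚSolver.+-*-Solver

  Degree<-x* : ∀ d {f} → Degree< d f → Degree< (suc d) λ x → x ℚ.* f x
  Degree<-x* zero {f} f≡0 =
    Degree<-suc zero λ x → trans (cong (x ℚ.*_) (f≡0 x)) (ℚ.*-zeroʳ x)
  Degree<-x* (suc d) {f} D a =
    let g , E , f≡ = D a
    -- From f(x) = f(a) + (x - a) g(x) follows x f(x) = a f(a) + (x - a)(f(a) + x g(x)), and the
    -- recursive call bounds x g(x).
    in (λ x → f a ℚ.+ x ℚ.* g x)
     , Degree<-+ (suc d) (Degree<-const d (f a)) (Degree<-x* d E)
     , λ x → trans (cong (x ℚ.*_) (f≡ x))
         (solve 4 (λ x a y z → x :* (y :+ (x :- a) :* z) := a :* y :+ (x :- a) :* (y :+ x :* z))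
            refl x a (f a) (g x))
    where open ℚSolver.+-*-Solver

  evalℚ-Degree< : ∀ p → ∃[ d ] Degree< d (evalℚ p)
  evalℚ-Degree< [] = 0 , λ _ → refl
  evalℚ-Degree< ((r , k ∷ []) ∷ p) =
    let d , D = evalℚ-Degree< p
    -- The sum of the two bounds is a crude substitute for their maximum; any bound will do.
    in d ℕ.+ suc k
     , Degree<-+ (d ℕ.+ suc k) (Degree<-+ˡ d (term k))
         (subst (λ c → Degree< c (evalℚ p)) (ℕ.+-comm (suc k) d) (Degree<-+ˡ (suc k) D))
    where
    open ℚSolver.+-*-Solver
    term : ∀ k → Degree< (suc k) λ x → r ℚ.* (x ^ℚ k ℚ.* 1ℚ)
    term zero    = Degree<-const 0 _
    term (suc k) = Degree<-cong (suc (suc k))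
      (λ x → solve 3 (λ r x y → r :* (x :* y :* con 1ℚ) := x :* (r :* (y :* con 1ℚ)))
               refl r x (x ^ℚ k))
      (Degree<-x* (suc k) (term k))

  -- Induction on `d`: divide by x - `s M`. Since `s` is injective, the quotient vanishes at every
  -- later `s i`, which is again an infinite supply of roots, so it is zero by induction.
  infinitely-many-roots⇒0 : ∀ d {f} → Degree< d f → ∀ (s : ℕ → ℚ) → (∀ {i j} → s i ≡ s j → i ≡ j) →
    ∀ M → (∀ i → M ≤ i → f (s i) ≡ 0ℚ) → ∀ x → f x ≡ 0ℚ
  infinitely-many-roots⇒0 zero    D _ _     _ _     = D
  infinitely-many-roots⇒0 (suc d) {f} D s s-inj M roots x = begin
    f x                                ≡⟨ f≡ x ⟩
    f (s M) ℚ.+ (x ℚ.- s M) ℚ.* g x    ≡⟨ cong₂ (λ y z → y ℚ.+ (x ℚ.- s M) ℚ.* z)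
                                            (roots M ℕ.≤-refl) (g≡0 x) ⟩
    0ℚ ℚ.+ (x ℚ.- s M) ℚ.* 0ℚ          ≡⟨ solve 1 (λ t → con 0ℚ :+ t :* con 0ℚ := con 0ℚ)
                                            refl (x ℚ.- s M) ⟩
    0ℚ                                 ∎
    where
    open ≡.≡-Reasoning
    open ℚSolver.+-*-Solver
    open GroupProperties ℚ.+-0-group using (x∙y⁻¹≈ε⇒x≈y)
    g : ℚ → ℚ
    g = proj₁ (D (s M))
    f≡ : ∀ x → f x ≡ f (s M) ℚ.+ (x ℚ.- s M) ℚ.* g x
    f≡ = proj₂ (proj₂ (D (s M)))
    g-roots : ∀ i → suc M ≤ i → g (s i) ≡ 0ℚ
    g-roots i M<i = *-cancelˡ-0
      (λ si-sM≡0 → ℕ.<⇒≢ M<i (sym (s-inj (x∙y⁻¹≈ε⇒x≈y _ _ si-sM≡0))))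
      (begin
        (s i ℚ.- s M) ℚ.* g (s i)                  ≡⟨ ℚ.+-identityˡ _ ⟨
        0ℚ ℚ.+ (s i ℚ.- s M) ℚ.* g (s i)           ≡⟨ cong (ℚ._+ (s i ℚ.- s M) ℚ.* g (s i)) (roots M ℕ.≤-refl) ⟨
        f (s M) ℚ.+ (s i ℚ.- s M) ℚ.* g (s i)      ≡⟨ f≡ (s i) ⟨
        f (s i)                                    ≡⟨ roots i (ℕ.<⇒≤ M<i) ⟩
        0ℚ                                         ∎)
    g≡0 : ∀ x → g x ≡ 0ℚ
    g≡0 = infinitely-many-roots⇒0 d (proj₁ (proj₂ (D (s M)))) s s-inj (suc M) g-roots

  parity : ℕ → ℚ
  parity zero          = 0ℚ
  parity (suc zero)    = 1ℚ
  parity (suc (suc n)) = parity n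

  parity-even : ∀ m → parity (m ℕ.* 2) ≡ 0ℚ
  parity-even zero    = refl
  parity-even (suc m) = parity-even m

  parity-odd : ∀ m → parity (suc (m ℕ.* 2)) ≡ 1ℚ
  parity-odd zero    = refl
  parity-odd (suc m) = parity-odd m

  parity-not-rational : ∀ R N (defined : ∀ n → N ≤ n → DefinedAt R n) →
    ¬ (∀ n (N≤n : N ≤ n) → parity n ≡ valueAt R n (defined n N≤n))
  parity-not-rational R N defined agree = 1≢0 (begin
    1ℚ                                        ≡⟨ parity-odd N ⟨
    parity (suc (N ℕ.* 2))                    ≡⟨ agree _ N≤odd ⟩
    evalℚ num (fromℕ (suc (N ℕ.* 2))) ℚ.* q   ≡⟨ cong (ℚ._* q) (num≡0 _) ⟩
    0ℚ ℚ.* q                                  ≡⟨ ℚ.*-zeroˡ q ⟩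
    0ℚ                                        ∎)
    where
    open ≡.≡-Reasoning
    open RationalFunction R
    1≢0 : 1ℚ ≢ 0ℚ
    1≢0 ()
    N≤N*2 : N ≤ N ℕ.* 2
    N≤N*2 = ℕ.m≤m*n N 2
    N≤odd : N ≤ suc (N ℕ.* 2)
    N≤odd = ℕ.m≤n⇒m≤1+n N≤N*2
    -- The reciprocal to which `valueAt` unfolds at this odd argument.
    q = ℚ.1/_ (evalℚ den (fromℕ (suc (N ℕ.* 2)))) {{≢-nonZero (defined _ N≤odd)}}
    num-even : ∀ m → N ≤ m → evalℚ num (fromℕ (m ℕ.* 2)) ≡ 0ℚ
    num-even m N≤m = begin
      y                       ≡⟨ ℚ.*-identityʳ y ⟨
      y ℚ.* 1ℚ                ≡⟨ cong (y ℚ.*_) (ℚ.*-inverseˡ z) ⟨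
      y ℚ.* (ℚ.1/ z ℚ.* z)    ≡⟨ ℚ.*-assoc y (ℚ.1/ z) z ⟨
      -- `y ℚ.* ℚ.1/ z` is `valueAt` at an even argument, hence equal to its parity 0.
      y ℚ.* ℚ.1/ z ℚ.* z      ≡⟨ cong (ℚ._* z) (trans (sym (agree _ N≤2m)) (parity-even m)) ⟩
      0ℚ ℚ.* z                ≡⟨ ℚ.*-zeroˡ z ⟩
      0ℚ                      ∎
      where
      N≤2m : N ≤ m ℕ.* 2
      N≤2m = ℕ.≤-trans N≤m (ℕ.m≤m*n m 2)
      y = evalℚ num (fromℕ (m ℕ.* 2))
      z = evalℚ den (fromℕ (m ℕ.* 2))
      instance _ = ≢-nonZero (defined (m ℕ.* 2) N≤2m)
    num≡0 : ∀ x → evalℚ num x ≡ 0ℚ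
    num≡0 = infinitely-many-roots⇒0 _ (proj₂ (evalℚ-Degree< num))
      (λ m → fromℕ (m ℕ.* 2)) (λ {i} {j} → ℕ.*-cancelʳ-≡ i j 2 ∘ fromℕ-injective) N num-even

open RationalFunctions using (fromℕ-injective; fromℕ-suc; parity; parity-not-rational)

private variable
  c ℓ₁ ℓ₂ : Level

-- Cosines in the cyclotomic field of level n = `suc m`.

module Cosines {m : ℕ} (K : CyclotomicField c ℓ₁ ℓ₂ (suc m)) where

  open CyclotomicField K hiding (_^_)
  open CommutativeRing commutativeRing
    hiding (Carrier; _≈_; _+_; _*_; -_; 0#; 1#; rawRing; zero)
  open Exp commutativeSemiring
  open RawSemiringDefs (CyclotomicField.rawSemiring K) using (product)
  open import Relation.Binary.Reasoning.Setoid setoid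
  open HeytingProperties heytingCommutativeRing using (x-0≈x)
  open GroupProperties +-group using (x∙y⁻¹≈ε⇒x≈y)
  module ι = IsRingMonomorphism ι-isMonomorphism

  -- Lets the ring solver carry rational constants such as ½ into the field.
  ι-morphism : ℚ.+-*-rawRing -Raw-AlmostCommutative⟶ fromCommutativeRing commutativeRing
  ι-morphism = record
    { ⟦_⟧ = ι; +-homo = ι.+-homo; *-homo = ι.*-homo; -‿homo = ι.-‿homo
    ; 0-homo = ι.0#-homo; 1-homo = ι.1#-homo }

  ι≟ : WeaklyDecidable (Induced-equivalence ι-morphism)
  ι≟ p q = Maybe.map ι.⟦⟧-cong (dec⇒maybe (p ℚ.≟ q))

  open Algebra.Solver.Ring ℚ.+-*-rawRing (fromCommutativeRing commutativeRing) ι-morphism ι≟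
    public using (solve; con; _:=_; _:+_; _:*_; _:^_; _:-_; :-_)
    renaming (Polynomial to SolverPolynomial)

  -- con 1ℚ would denote ι 1ℚ, which is only ≈ 1#.
  :1 : ∀ {n} → SolverPolynomial n
  :1 = con 0ℚ :^ 0

  -- In a Heyting field `¬ (x ≈ 0#)` does not by itself provide an inverse of `x`. Tightness reduces
  -- the goal to refuting `y # 0#`, and there it is `y` that can be inverted, which forces `x ≈ 0#`.
  *-cancelˡ-0 : ∀ {x y} → ¬ (x ≈ 0#) → x * y ≈ 0# → y ≈ 0#
  *-cancelˡ-0 {x} {y} x≉0 xy≈0 = proj₁ (HeytingField.tight heytingField y 0#) λ y#0 →
    let y⁻¹ , _ , yy⁻¹≈1 = HeytingField.#⇒invertible heytingField y#0
    in x≉0 (begin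
      x                      ≈⟨ *-identityʳ x ⟨
      x * 1#                 ≈⟨ *-congˡ yy⁻¹≈1 ⟨
      x * ((y - 0#) * y⁻¹)   ≈⟨ *-congˡ (*-congʳ (x-0≈x y)) ⟩
      x * (y * y⁻¹)          ≈⟨ *-assoc x y y⁻¹ ⟨
      x * y * y⁻¹            ≈⟨ *-congʳ xy≈0 ⟩
      0# * y⁻¹               ≈⟨ zeroˡ y⁻¹ ⟩
      0#                     ∎)

  cancel-geometric : ∀ {u} → ¬ (u ≈ 1#) → ∀ {y} → (1# - u) * y ≈ 0# → y ≈ 0#
  cancel-geometric u≉1 = *-cancelˡ-0 λ 1-u≈0 → u≉1 (sym (x∙y⁻¹≈ε⇒x≈y _ _ 1-u≈0))

  -- The inverse of `ω`, since m = n - 1.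
  ω̄ : Carrier
  ω̄ = ω ^ m

  ωω̄≈1 : ω * ω̄ ≈ 1#
  ωω̄≈1 = ω^n≈1

  1^ : ∀ j → 1# ^ j ≈ 1#
  1^ zero    = refl
  1^ (suc j) = trans (*-identityˡ _) (1^ j)

  ^-swap : ∀ x i j → (x ^ i) ^ j ≈ (x ^ j) ^ i
  ^-swap x i j = trans (^-assocʳ x i j)
    (trans (^-congʳ x (ℕ.*-comm i j)) (sym (^-assocʳ x j i)))

  ω̄^n≈1 : ω̄ ^ suc m ≈ 1#
  ω̄^n≈1 = trans (^-swap ω m (suc m)) (trans (^-congˡ m ω^n≈1) (1^ m))

  ω^jω̄^j≈1 : ∀ j → ω ^ j * ω̄ ^ j ≈ 1#
  ω^jω̄^j≈1 j = trans (sym (^-distrib-* ω ω̄ j)) (trans (^-congˡ j ωω̄≈1) (1^ j))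

  ω̄^m≈ω : ω̄ ^ m ≈ ω
  ω̄^m≈ω = begin
    ω̄ ^ m                ≈⟨ *-identityˡ _ ⟨
    1# * ω̄ ^ m           ≈⟨ *-congʳ ωω̄≈1 ⟨
    ω * ω̄ * ω̄ ^ m        ≈⟨ *-assoc _ _ _ ⟩
    ω * ω̄ ^ suc m        ≈⟨ *-congˡ ω̄^n≈1 ⟩
    ω * 1#               ≈⟨ *-identityʳ ω ⟩
    ω                    ∎

  -- cos(2πj/n) for every j, not only j ≤ n as for cosine.
  cos : ℕ → Carrier
  cos j = ι ½ * (ω ^ j + ω̄ ^ j)

  ω^[n∸j]≈ω̄^j : ∀ {j} → j ≤ suc m → ω ^ (suc m ∸ j) ≈ ω̄ ^ j
  ω^[n∸j]≈ω̄^j {j} j≤n = begin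
    ω ^ (suc m ∸ j)                      ≈⟨ *-identityˡ _ ⟨
    1# * ω ^ (suc m ∸ j)                 ≈⟨ *-congʳ (ω^jω̄^j≈1 j) ⟨
    ω ^ j * ω̄ ^ j * ω ^ (suc m ∸ j)      ≈⟨ solve 3 (λ x y z → x :* y :* z := x :* z :* y) refl _ _ _ ⟩
    ω ^ j * ω ^ (suc m ∸ j) * ω̄ ^ j      ≈⟨ *-congʳ (^-homo-* ω j (suc m ∸ j)) ⟨
    ω ^ (j ℕ.+ (suc m ∸ j)) * ω̄ ^ j      ≈⟨ *-congʳ (^-congʳ ω (ℕ.m+[n∸m]≡n j≤n)) ⟩
    ω ^ suc m * ω̄ ^ j                    ≈⟨ *-congʳ ω^n≈1 ⟩
    1# * ω̄ ^ j                           ≈⟨ *-identityˡ _ ⟩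
    ω̄ ^ j                                ∎

  cosine≈cos : ∀ {j} → j ≤ suc m → cosine j ≈ cos j
  cosine≈cos j≤n = *-congˡ (+-congˡ (ω^[n∸j]≈ω̄^j j≤n))

  cos-0 : cos 0 ≈ 1#
  cos-0 = solve 0 (con ½ :* (:1 :+ :1) := :1) refl

  -- `m` is -1 modulo n and the cosine is even. This identifies the last cosine point with
  -- cos(2π/n).
  cos-m : cos m ≈ cos 1
  cos-m = *-congˡ (trans (+-comm _ _) (+-cong (trans ω̄^m≈ω (sym (*-identityʳ ω))) (sym (*-identityʳ ω̄))))

  ^-periodic : ∀ {x} → x ^ suc m ≈ 1# → ∀ r q → x ^ (r ℕ.+ q ℕ.* suc m) ≈ x ^ r
  ^-periodic {x} x^n≈1 r q = begin
    x ^ (r ℕ.+ q ℕ.* suc m)     ≈⟨ ^-homo-* x r (q ℕ.* suc m) ⟩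
    x ^ r * x ^ (q ℕ.* suc m)   ≈⟨ *-congˡ (^-congʳ x (ℕ.*-comm q (suc m))) ⟩
    x ^ r * x ^ (suc m ℕ.* q)   ≈⟨ *-congˡ (^-assocʳ x (suc m) q) ⟨
    x ^ r * (x ^ suc m) ^ q     ≈⟨ *-congˡ (trans (^-congˡ q x^n≈1) (1^ q)) ⟩
    x ^ r * 1#                  ≈⟨ *-identityʳ _ ⟩
    x ^ r                       ∎

  cos-periodic : ∀ r q → cos (r ℕ.+ q ℕ.* suc m) ≈ cos r
  cos-periodic r q = *-congˡ (+-cong (^-periodic ω^n≈1 r q) (^-periodic ω̄^n≈1 r q))

  -- Since m ≡ -1 modulo n, the index i + mj stands for i − j.
  cos-* : ∀ i j → cos i * cos j ≈ ι ½ * cos (i ℕ.+ j) + ι ½ * cos (i ℕ.+ m ℕ.* j)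
  cos-* i j = begin
    cos i * cos j
      ≈⟨ solve 4 (λ x x̄ y ȳ → con ½ :* (x :+ x̄) :* (con ½ :* (y :+ ȳ))
                  := con ½ :* (con ½ :* (x :* y :+ x̄ :* ȳ)) :+ con ½ :* (con ½ :* (x :* ȳ :+ x̄ :* y)))
           refl (ω ^ i) (ω̄ ^ i) (ω ^ j) (ω̄ ^ j) ⟩
    ι ½ * (ι ½ * (ω ^ i * ω ^ j + ω̄ ^ i * ω̄ ^ j)) + ι ½ * (ι ½ * (ω ^ i * ω̄ ^ j + ω̄ ^ i * ω ^ j))
      ≈⟨ +-cong (*-congˡ (*-congˡ (+-cong (^-homo-* ω i j) (^-homo-* ω̄ i j))))
                (*-congˡ (*-congˡ (+-cong
                  (trans (^-homo-* ω i (m ℕ.* j)) (*-congˡ (sym (^-assocʳ ω m j))))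
                  (trans (^-homo-* ω̄ i (m ℕ.* j)) (*-congˡ (trans (sym (^-assocʳ ω̄ m j)) (^-congˡ j ω̄^m≈ω))))))) ⟨
    ι ½ * cos (i ℕ.+ j) + ι ½ * cos (i ℕ.+ m ℕ.* j) ∎

  -- The rational span of the cosines is a ring.

  infixl 6 _⊕_

  -- Membership is recorded as a derivation, so that products and affine polynomials can be computed
  -- by recursion on it. The index `j` ranges over all naturals; reduction modulo n is postponed to
  -- `affine-cos`.
  data CosineSpan : Carrier → Set (c ⊔ ℓ₁) where
    term : ∀ q j → CosineSpan (ι q * cos j)
    _⊕_  : ∀ {x y} → CosineSpan x → CosineSpan y → CosineSpan (x + y)
    resp : ∀ {x y} → x ≈ y → CosineSpan x → CosineSpan y

  rational : ∀ q → CosineSpan (ι q)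
  rational q = resp (trans (*-congˡ cos-0) (*-identityʳ _)) (term q 0)

  -- Two single terms multiply by the product-to-sum formula `cos-*`; the remaining clauses are
  -- bilinearity.
  _⊗_ : ∀ {x y} → CosineSpan x → CosineSpan y → CosineSpan (x * y)
  term p i ⊗ term q j = resp
    (begin
      ι (p ℚ.* q ℚ.* ½) * cos (i ℕ.+ j) + ι (p ℚ.* q ℚ.* ½) * cos (i ℕ.+ m ℕ.* j)
        ≈⟨ +-cong (*-congʳ hom) (*-congʳ hom) ⟩
      ι p * ι q * ι ½ * cos (i ℕ.+ j) + ι p * ι q * ι ½ * cos (i ℕ.+ m ℕ.* j)
        ≈⟨ solve 4 (λ p q y z → p :* q :* con ½ :* y :+ p :* q :* con ½ :* z
                    := p :* q :* (con ½ :* y :+ con ½ :* z)) refl _ _ _ _ ⟩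
      ι p * ι q * (ι ½ * cos (i ℕ.+ j) + ι ½ * cos (i ℕ.+ m ℕ.* j))
        ≈⟨ *-congˡ (cos-* i j) ⟨
      ι p * ι q * (cos i * cos j)
        ≈⟨ solve 4 (λ p q y z → p :* q :* (y :* z) := p :* y :* (q :* z)) refl _ _ _ _ ⟩
      ι p * cos i * (ι q * cos j) ∎)
    (term (p ℚ.* q ℚ.* ½) (i ℕ.+ j) ⊕ term (p ℚ.* q ℚ.* ½) (i ℕ.+ m ℕ.* j))
    where
    hom : ι (p ℚ.* q ℚ.* ½) ≈ ι p * ι q * ι ½
    hom = trans (ι.*-homo _ _) (*-congʳ (ι.*-homo p q))
  s@(term _ _) ⊗ (t ⊕ u)    = resp (sym (distribˡ _ _ _)) (s ⊗ t ⊕ s ⊗ u)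
  s@(term _ _) ⊗ resp y≈z t = resp (*-congˡ y≈z) (s ⊗ t)
  (s ⊕ t)      ⊗ u          = resp (sym (distribʳ _ _ _)) (s ⊗ u ⊕ t ⊗ u)
  resp x≈y s   ⊗ t          = resp (*-congʳ x≈y) (s ⊗ t)

  one : CosineSpan 1#
  one = resp cos-0 (resp (trans (*-congʳ ι.1#-homo) (*-identityˡ _)) (term 1ℚ 0))

  power : ∀ {x} → CosineSpan x → ∀ k → CosineSpan (x ^ k)
  power s zero    = one
  power s (suc k) = s ⊗ power s k

  monomial-span : ∀ {k} (x : Fin k → Carrier) → (∀ i → CosineSpan (x i)) →
    ∀ e → CosineSpan (product λ i → x i ^ lookup e i)
  monomial-span x s []      = one
  monomial-span x s (k ∷ e) = power (s zero) k ⊗ monomial-span (x ∘ suc) (s ∘ suc) e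

  -- Places the value contributed by the earlier variables in the span, so that its difference from
  -- the prescribed rational lies there too.
  evaluate-span : ∀ {k} {x : Fin k → Carrier} → (∀ i → CosineSpan (x i)) →
    ∀ p → CosineSpan (evaluate rawSemiring ι p x)
  evaluate-span s []            = resp ι.0#-homo (rational 0ℚ)
  evaluate-span s ((q , e) ∷ p) = rational q ⊗ monomial-span _ s e ⊕ evaluate-span s p

  point : Fin m → Carrier
  point i = cosine (suc (toℕ i))

  point≈cos : ∀ i → point i ≈ cos (suc (toℕ i))
  point≈cos i = cosine≈cos (s≤s (ℕ.<⇒≤ (Fin.toℕ<n i)))

  point-span : ∀ i → CosineSpan (point i)
  point-span i = resp (trans (*-congʳ ι.1#-homo) (trans (*-identityˡ _) (sym (point≈cos i))))
    (term 1ℚ (suc (toℕ i)))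

  open Evaluation commutativeSemiring ι point

  -- Span elements as values of affine polynomials.

  Affine : Carrier → Set ℓ₁
  Affine x = ∃[ p ] Exponents≤ 1 p × eval p ≈ x

  -- `cos 0` is 1 and is obtained from the constant polynomial; each other residue indexes one of
  -- the points and is obtained from a single variable.
  affine-cos-< : ∀ r → r < suc m → Affine (cos r)
  affine-cos-< zero _ =
    (1ℚ , replicate m 0) ∷ []
    , ℕ.≤-trans (ℕ.≤-reflexive (sum-replicate0 m)) z≤n ∷ []
    , (begin
        ι 1ℚ * monomial point (replicate m 0) + 0#  ≈⟨ +-identityʳ _ ⟩
        ι 1ℚ * monomial point (replicate m 0)       ≈⟨ *-cong ι.1#-homo (monomial-0 point) ⟩
        1# * 1#                                     ≈⟨ *-identityˡ 1# ⟩
        1#                                          ≈⟨ cos-0 ⟨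
        cos 0                                       ∎)
  affine-cos-< (suc r) (s≤s r<m) =
    (1ℚ , updateAt (replicate m 0) i suc) ∷ []
    , ℕ.≤-reflexive (≡.trans (sum-updateAt-suc (replicate m 0) i) (≡.cong suc (sum-replicate0 m))) ∷ []
    , (begin
        ι 1ℚ * monomial point (updateAt (replicate m 0) i suc) + 0#
          ≈⟨ +-identityʳ _ ⟩
        ι 1ℚ * monomial point (updateAt (replicate m 0) i suc)
          ≈⟨ *-cong ι.1#-homo (trans (monomial-updateAt-suc point (replicate m 0) i) (*-congˡ (monomial-0 point))) ⟩
        1# * (point i * 1#)
          ≈⟨ trans (*-identityˡ _) (*-identityʳ _) ⟩
        point i
          ≈⟨ point≈cos i ⟩
        cos (suc (toℕ i))
          ≡⟨ ≡.cong (cos ∘ suc) (Fin.toℕ-fromℕ< r<m) ⟩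
        cos (suc r) ∎)
    where i = fromℕ< r<m

  affine-cos : ∀ j → Affine (cos j)
  affine-cos j =
    let p , p≤1 , eq = affine-cos-< (j % suc m) (m%n<n j (suc m))
    in p , p≤1 , trans eq (sym (trans (reflexive (≡.cong cos (m≡m%n+[m/n]*n j (suc m))))
                                      (cos-periodic (j % suc m) (j / suc m))))

  -- However many products went into a span element, it is the value of a polynomial of degree at
  -- most 1. The uniform degree bound of the family rests on this.
  affine : ∀ {x} → CosineSpan x → Affine x
  affine (term q j) =
    let p , p≤1 , eq = affine-cos j
    in scale q p , Exponents≤-scale q p≤1 , trans (eval-scale ι.*-homo q p) (*-congˡ eq)
  affine (s ⊕ t) =
    let p , p≤1 , eq₁ = affine s
        q , q≤1 , eq₂ = affine t
    in p ++ q , All.++⁺ p≤1 q≤1 , trans (eval-++ p q) (+-cong eq₁ eq₂)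
  affine (resp x≈y s) =
    let p , p≤1 , eq = affine s
    in p , p≤1 , trans eq x≈y

  -- Inverting cos(2π/n) inside the span.

  geometric : Carrier → ℕ → Carrier
  geometric u zero    = 0#
  geometric u (suc k) = geometric u k + u ^ k

  [1-u]*geometric : ∀ u k → (1# - u) * geometric u k ≈ 1# - u ^ k
  [1-u]*geometric u zero    = trans (zeroʳ _) (sym (-‿inverseʳ 1#))
  [1-u]*geometric u (suc k) = begin
    (1# - u) * (geometric u k + u ^ k)              ≈⟨ distribˡ _ _ _ ⟩
    (1# - u) * geometric u k + (1# - u) * u ^ k     ≈⟨ +-congʳ ([1-u]*geometric u k) ⟩
    (1# - u ^ k) + (1# - u) * u ^ k
      ≈⟨ solve 2 (λ u v → (:1 :- v) :+ (:1 :- u) :* v := :1 :- u :* v) refl u (u ^ k) ⟩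
    1# - u ^ suc k                                  ∎

  geometric≈0 : ∀ {u} k → ¬ (u ≈ 1#) → u ^ k ≈ 1# → geometric u k ≈ 0#
  geometric≈0 {u} k u≉1 u^k≈1 = cancel-geometric u≉1 (begin
    (1# - u) * geometric u k   ≈⟨ [1-u]*geometric u k ⟩
    1# - u ^ k                 ≈⟨ +-congˡ (-‿cong u^k≈1) ⟩
    1# - 1#                    ≈⟨ -‿inverseʳ 1# ⟩
    0#                         ∎)

  sign : ℕ → ℚ
  sign zero    = 1ℚ
  sign (suc k) = ℚ.- sign k

  sign-even : ∀ k → sign (k ℕ.* 2) ≡ 1ℚ
  sign-even zero    = ≡.refl
  sign-even (suc k) = ≡.cong (λ q → ℚ.- (ℚ.- q)) (sign-even k)

  [-x²]^k : ∀ x k → (- (x * x)) ^ k ≈ ι (sign k) * x ^ (k ℕ.* 2)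
  [-x²]^k x zero    = sym (trans (*-identityʳ _) ι.1#-homo)
  [-x²]^k x (suc k) = begin
    - (x * x) * (- (x * x)) ^ k                       ≈⟨ *-congˡ ([-x²]^k x k) ⟩
    - (x * x) * (ι (sign k) * x ^ (k ℕ.* 2))
      ≈⟨ solve 3 (λ x s y → :- (x :* x) :* (s :* y) := :- s :* (x :* (x :* y))) refl x _ _ ⟩
    - ι (sign k) * x ^ (suc k ℕ.* 2)                  ≈⟨ *-congʳ (ι.-‿homo _) ⟨
    ι (sign (suc k)) * x ^ (suc k ℕ.* 2)              ∎

  -- Put u = -ω².  As u²ⁿ = 1 ≠ u, the inverse of 1 - u is -1/2n times
  -- Σ_{j<2n} (j + 1) uʲ, and ωω̄ = 1 gives 1/(ω + ω̄) = ω/(1 - u).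
  weight : ℕ → ℚ
  weight j = fromℕ (suc j) ℚ.* sign j

  -- The argument `f` is `x ^_` in the algebraic identities and `cos` for membership in the span.
  -- The odd index 2k + 1 arises from x · (-x²)ᵏ = (-1)ᵏ x²ᵏ⁺¹.
  weightedSum : (ℕ → Carrier) → ℕ → Carrier
  weightedSum f zero    = 0#
  weightedSum f (suc k) = weightedSum f k + ι (weight k) * f (suc (k ℕ.* 2))

  ι-fromℕ-suc : ∀ k → ι (fromℕ (suc k)) ≈ 1# + ι (fromℕ k)
  ι-fromℕ-suc k = trans (ι.⟦⟧-cong (fromℕ-suc k)) (trans (ι.+-homo _ _) (+-congʳ ι.1#-homo))

  -- As x(x + x̄) = 1 + x² = 1 - u, the left side is (1 - u) times the sum of (j + 1) uʲ over j < k,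
  -- which telescopes.
  weightedSum-power : ∀ {x x̄} → x * x̄ ≈ 1# → ∀ k → let u = - (x * x) in
    (x + x̄) * weightedSum (x ^_) k ≈ geometric u k - ι (fromℕ k) * u ^ k
  weightedSum-power {x} {x̄} xx̄≈1 zero = begin
    (x + x̄) * 0#           ≈⟨ zeroʳ _ ⟩
    0#                     ≈⟨ -‿inverseʳ 0# ⟨
    0# - 0#                ≈⟨ +-congˡ (-‿cong (trans (*-congʳ ι.0#-homo) (zeroˡ _))) ⟨
    0# - ι 0ℚ * 1#         ∎
  weightedSum-power {x} {x̄} xx̄≈1 (suc k) = begin
    (x + x̄) * (weightedSum (x ^_) k + ι (weight k) * (x * y))
      ≈⟨ distribˡ _ _ _ ⟩
    (x + x̄) * weightedSum (x ^_) k + (x + x̄) * (ι (weight k) * (x * y))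
      ≈⟨ +-cong (weightedSum-power xx̄≈1 k) step ⟩
    (geometric u k - ι (fromℕ k) * v) + (1# + ι (fromℕ k)) * (1# - u) * v
      ≈⟨ solve 4 (λ g n u v → (g :- n :* v) :+ (:1 :+ n) :* (:1 :- u) :* v
                  := (g :+ v) :- (:1 :+ n) :* (u :* v)) refl _ _ u v ⟩
    (geometric u k + v) - (1# + ι (fromℕ k)) * (u * v)
      ≈⟨ +-congˡ (-‿cong (*-congʳ (ι-fromℕ-suc k))) ⟨
    geometric u (suc k) - ι (fromℕ (suc k)) * u ^ suc k ∎
    where
    u = - (x * x)
    v = u ^ k
    y = x ^ (k ℕ.* 2)
    s = ι (sign k)
    step : (x + x̄) * (ι (weight k) * (x * y)) ≈ (1# + ι (fromℕ k)) * (1# - u) * v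
    step = begin
      (x + x̄) * (ι (weight k) * (x * y))
        ≈⟨ *-congˡ (*-congʳ (trans (ι.*-homo _ _) (*-congʳ (ι-fromℕ-suc k)))) ⟩
      (x + x̄) * ((1# + ι (fromℕ k)) * s * (x * y))
        ≈⟨ solve 5 (λ x x̄ n s y → (x :+ x̄) :* ((:1 :+ n) :* s :* (x :* y))
                    := (:1 :+ n) :* (x :* x̄ :+ x :* x) :* (s :* y)) refl x x̄ _ s y ⟩
      (1# + ι (fromℕ k)) * (x * x̄ + x * x) * (s * y)
        ≈⟨ *-cong (*-congˡ (+-congʳ xx̄≈1)) (sym ([-x²]^k x k)) ⟩
      (1# + ι (fromℕ k)) * (1# + x * x) * v
        ≈⟨ solve 3 (λ n x v → (:1 :+ n) :* (:1 :+ x :* x) :* v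
                    := (:1 :+ n) :* (:1 :- :- (x :* x)) :* v) refl _ x v ⟩
      (1# + ι (fromℕ k)) * (1# - u) * v ∎

  weightedSum-cos : ∀ k →
    weightedSum cos k ≈ ι ½ * (weightedSum (ω ^_) k + weightedSum (ω̄ ^_) k)
  weightedSum-cos zero    = sym (trans (*-congˡ (+-identityˡ 0#)) (zeroʳ _))
  weightedSum-cos (suc k) = trans (+-congʳ (weightedSum-cos k))
    (solve 5 (λ a b w x y → con ½ :* (a :+ b) :+ w :* (con ½ :* (x :+ y))
              := con ½ :* ((a :+ w :* x) :+ (b :+ w :* y))) refl _ _ _ _ _)

  weightedSum-span : ∀ k → CosineSpan (weightedSum cos k)
  weightedSum-span zero    = resp ι.0#-homo (rational 0ℚ)
  weightedSum-span (suc k) = weightedSum-span k ⊕ term (weight k) (suc (k ℕ.* 2))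

  -- The exponent is 2n instead of n so that the sign is positive for odd n as well.
  [-x²]^2n≈1 : ∀ {x} → x ^ suc m ≈ 1# → (- (x * x)) ^ (suc m ℕ.* 2) ≈ 1#
  [-x²]^2n≈1 {x} x^n≈1 = begin
    (- (x * x)) ^ (suc m ℕ.* 2)
      ≈⟨ [-x²]^k x (suc m ℕ.* 2) ⟩
    ι (sign (suc m ℕ.* 2)) * x ^ (suc m ℕ.* 2 ℕ.* 2)
      ≈⟨ *-cong (trans (ι.⟦⟧-cong (sign-even (suc m))) ι.1#-homo) (sym (^-assocʳ x (suc m ℕ.* 2) 2)) ⟩
    1# * (x ^ (suc m ℕ.* 2)) ^ 2
      ≈⟨ *-identityˡ _ ⟩
    (x ^ (suc m ℕ.* 2)) ^ 2
      ≈⟨ ^-congˡ 2 (trans (sym (^-assocʳ x (suc m) 2)) (trans (^-congˡ 2 x^n≈1) (1^ 2))) ⟩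
    1# ^ 2
      ≈⟨ 1^ 2 ⟩
    1# ∎

  weightedSum-power-2n : ∀ {x x̄} → x * x̄ ≈ 1# → x ^ suc m ≈ 1# → ¬ (- (x * x) ≈ 1#) →
    (x + x̄) * weightedSum (x ^_) (suc m ℕ.* 2) ≈ - ι (fromℕ (suc m ℕ.* 2))
  weightedSum-power-2n {x} {x̄} xx̄≈1 x^n≈1 u≉1 = begin
    (x + x̄) * weightedSum (x ^_) N        ≈⟨ weightedSum-power xx̄≈1 N ⟩
    geometric u N - ι (fromℕ N) * u ^ N   ≈⟨ +-cong (geometric≈0 N u≉1 ([-x²]^2n≈1 x^n≈1))
                                               (-‿cong (trans (*-congˡ ([-x²]^2n≈1 x^n≈1)) (*-identityʳ _))) ⟩
    0# - ι (fromℕ N)                      ≈⟨ +-identityˡ _ ⟩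
    - ι (fromℕ N)                         ∎
    where
    u = - (x * x)
    N = suc m ℕ.* 2

  module _ (-ω²≉1 : ¬ (- (ω * ω) ≈ 1#)) where

    -ω̄²≉1 : ¬ (- (ω̄ * ω̄) ≈ 1#)
    -ω̄²≉1 -ω̄²≈1 = -ω²≉1 (begin
      - (ω * ω)                      ≈⟨ *-identityʳ _ ⟨
      - (ω * ω) * 1#                 ≈⟨ *-congˡ -ω̄²≈1 ⟨
      - (ω * ω) * - (ω̄ * ω̄)          ≈⟨ solve 2 (λ x y → :- (x :* x) :* :- (y :* y) := x :* y :* (x :* y)) refl ω ω̄ ⟩
      ω * ω̄ * (ω * ω̄)                ≈⟨ *-cong ωω̄≈1 ωω̄≈1 ⟩
      1# * 1#                        ≈⟨ *-identityˡ 1# ⟩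
      1#                             ∎)

    secant : ∃[ y ] CosineSpan y × cos 1 * y ≈ 1#
    -- The constant is -2/d with d = 2n. Both `cos 1` and `weightedSum cos N` are half a sum of
    -- conjugates, and `weightedSum-power-2n` gives -d for each conjugate, so their product is (-d -
    -- d)/4 = -d/2.
    secant = ι (ℚ.- (1ℚ ℚ.+ 1ℚ) ℚ.* ℚ.1/ d) * weightedSum cos N
           , rational _ ⊗ weightedSum-span N
           , (begin
      cos 1 * (ι (ℚ.- (1ℚ ℚ.+ 1ℚ) ℚ.* ℚ.1/ d) * weightedSum cos N)
        ≈⟨ *-congˡ (*-cong (ι.*-homo _ _) (weightedSum-cos N)) ⟩
      cos 1 * (ι (ℚ.- (1ℚ ℚ.+ 1ℚ)) * ι (ℚ.1/ d) * (ι ½ * (weightedSum (ω ^_) N + weightedSum (ω̄ ^_) N)))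
        ≈⟨ solve 5 (λ x x̄ c s t →
             con ½ :* (x :* :1 :+ x̄ :* :1) :* (con (ℚ.- (1ℚ ℚ.+ 1ℚ)) :* c :* (con ½ :* (s :+ t)))
             := con ½ :* (c :* (:- ((x :+ x̄) :* s) :+ :- ((x̄ :+ x) :* t)))) refl ω ω̄ _ _ _ ⟩
      ι ½ * (ι (ℚ.1/ d) * (- ((ω + ω̄) * weightedSum (ω ^_) N) + - ((ω̄ + ω) * weightedSum (ω̄ ^_) N)))
        ≈⟨ *-congˡ (*-congˡ (+-cong
             (-‿cong (weightedSum-power-2n ωω̄≈1 ω^n≈1 -ω²≉1))
             (-‿cong (weightedSum-power-2n (trans (*-comm ω̄ ω) ωω̄≈1) ω̄^n≈1 -ω̄²≉1)))) ⟩
      ι ½ * (ι (ℚ.1/ d) * (- - ι d + - - ι d))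
        ≈⟨ solve 2 (λ x y → con ½ :* (x :* (:- :- y :+ :- :- y)) := x :* y) refl _ _ ⟩
      ι (ℚ.1/ d) * ι d
        ≈⟨ ι.*-homo _ _ ⟨
      ι (ℚ.1/ d ℚ.* d)
        ≈⟨ ι.⟦⟧-cong (ℚ.*-inverseˡ d) ⟩
      ι 1ℚ
        ≈⟨ ι.1#-homo ⟩
      1# ∎)
      where
      N = suc m ℕ.* 2
      d = fromℕ N
      d≢0 : d ≢ 0ℚ
      d≢0 d≡0 with () ← fromℕ-injective {N} {0} d≡0
      instance _ = ℚ.≢-nonZero d≢0

-- Reaching a prescribed value by means of the last variable.

module LastVariable {m : ℕ} (K : CyclotomicField c ℓ₁ ℓ₂ (2 ℕ.+ m)) where

  open CyclotomicField K using (_≈_; _*_; _+_; -_; 1#; ω; ι; rawSemiring; commutativeRing)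
  open Cosines K
  open CommutativeRing commutativeRing
    using (setoid; refl; sym; trans; +-cong; +-congˡ; *-cong; *-congˡ; *-congʳ; *-assoc; *-identityˡ
          ; commutativeSemiring; _-_)
  open Evaluation commutativeSemiring ι point
  open import Relation.Binary.Reasoning.Setoid setoid

  point-last : point (maxFin m) ≈ cos 1
  point-last = trans (point≈cos (maxFin m))
    (trans (CommutativeRing.reflexive commutativeRing (≡.cong (cos ∘ suc) (Fin.toℕ-fromℕ m))) cos-m)

  solve-extension : ¬ (- (ω * ω) ≈ 1#) → ∀ (p : Polynomial m) b →
    ∃[ r ] Exponents≤ 1 r × eval (extend p r) ≈ ι b
  solve-extension -ω²≉1 p b =
    let y , y-span , cos1*y≈1 = secant -ω²≉1
        z = eval (addVariable p)
        z-span = evaluate-span point-span (addVariable p)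
        -- `CosineSpan` has no constructor for negation, so -z enters as the product (-1) · z.
        -z-span = resp (solve 1 (λ z → con (ℚ.- 1ℚ) :* z := :- z) refl z) (rational (ℚ.- 1ℚ) ⊗ z-span)
        r , r≤1 , r≈ = affine (y-span ⊗ (rational b ⊕ -z-span))
    in r , r≤1 , (begin
      eval (extend p r)
        ≈⟨ eval-++ (addVariable p) (r ·var maxFin m) ⟩
      z + eval (r ·var maxFin m)
        ≈⟨ +-congˡ (eval-·var r (maxFin m)) ⟩
      z + point (maxFin m) * eval r
        ≈⟨ +-congˡ (*-cong point-last r≈) ⟩
      z + cos 1 * (y * (ι b - z))
        ≈⟨ +-congˡ (*-assoc _ _ _) ⟨
      z + cos 1 * y * (ι b - z)
        ≈⟨ +-congˡ (*-congʳ cos1*y≈1) ⟩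
      z + 1# * (ι b - z)
        ≈⟨ solve 2 (λ z b → z :+ :1 :* (b :- z) := b) refl z (ι b) ⟩
      ι b ∎)

-- Squaring -ω² = 1 would give ω⁴ = 1, against primitivity because 4 < n.
-ω²≉1 : ∀ {k} (K : CyclotomicField c ℓ₁ ℓ₂ (5 ℕ.+ k)) →
  let open CyclotomicField K in ¬ (- (ω * ω) ≈ 1#)
-ω²≉1 K -ω²≈1 = ω-primitive 4 (s≤s z≤n) (s≤s (s≤s (s≤s (s≤s (s≤s z≤n))))) (begin
  ω ^ 4                      ≈⟨ solve 1 (λ w → w :* (w :* (w :* (w :* :1))) := :- (w :* w) :* :- (w :* w)) refl ω ⟩
  - (ω * ω) * - (ω * ω)      ≈⟨ *-cong -ω²≈1 -ω²≈1 ⟩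
  1# * 1#                    ≈⟨ *-identityˡ 1# ⟩
  1#                         ∎)
  where
  open CyclotomicField K
  open Cosines K
  open CommutativeRing commutativeRing using (setoid; refl; *-cong; *-identityˡ)
  open import Relation.Binary.Reasoning.Setoid setoid

-- The second cosine point at levels 3 and 4.

point-3 : (K : CyclotomicField c ℓ₁ ℓ₂ 3) →
  let open CyclotomicField K in Cosines.point K (suc zero) ≈ ι -½
point-3 K = begin
  ι ½ * (ω * (ω * 1#) + ω * 1#)
    -- Adds and subtracts ½ to bring in 1 + ω + ω² = 0. The variable `z` stands for the literal `0#`
    -- at which `geometric` starts; it cancels between the two summands.
    ≈⟨ solve 2 (λ w z → con ½ :* (w :* (w :* :1) :+ w :* :1)
                 := con ½ :* (z :+ :1 :+ w :* :1 :+ w :* (w :* :1)) :+ con -½ :* (z :+ :1)) refl ω 0# ⟩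
  ι ½ * geometric ω 3 + ι -½ * (0# + 1#)
    ≈⟨ +-cong (*-congˡ (geometric≈0 3 ω≉1 ω^n≈1)) (*-congˡ (+-identityˡ 1#)) ⟩
  ι ½ * 0# + ι -½ * 1#
    ≈⟨ +-cong (zeroʳ _) (*-identityʳ _) ⟩
  0# + ι -½
    ≈⟨ +-identityˡ _ ⟩
  ι -½ ∎
  where
  open CyclotomicField K
  open Cosines K
  open CommutativeRing commutativeRing
    using (setoid; refl; trans; +-cong; *-congˡ; +-identityˡ; *-identityʳ; zeroʳ)
  open import Relation.Binary.Reasoning.Setoid setoid
  ω≉1 : ¬ (ω ≈ 1#)
  ω≉1 ω≈1 = ω-primitive 1 (s≤s z≤n) (s≤s (s≤s z≤n)) (trans (*-identityʳ ω) ω≈1)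

-- The point is ω² itself, and 1 + ω² is a geometric sum in ω² that vanishes because ω² ≠ 1 while ω⁴
-- = 1.
point-4 : (K : CyclotomicField c ℓ₁ ℓ₂ 4) →
  let open CyclotomicField K in Cosines.point K (suc zero) ≈ ι (ℚ.- 1ℚ)
point-4 K = begin
  ι ½ * (ω * (ω * 1#) + ω * (ω * 1#))
    ≈⟨ solve 2 (λ w z → con ½ :* (w :* (w :* :1) :+ w :* (w :* :1))
                 := (z :+ :1 :+ (w :* w) :* :1) :+ con (ℚ.- 1ℚ) :* (z :+ :1)) refl ω 0# ⟩
  geometric (ω * ω) 2 + ι (ℚ.- 1ℚ) * (0# + 1#)
    ≈⟨ +-cong (geometric≈0 2 ω²≉1 (trans ω²²≈ω⁴ ω^n≈1)) (*-congˡ (+-identityˡ 1#)) ⟩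
  0# + ι (ℚ.- 1ℚ) * 1#
    ≈⟨ trans (+-identityˡ _) (*-identityʳ _) ⟩
  ι (ℚ.- 1ℚ) ∎
  where
  open CyclotomicField K
  open Cosines K
  open CommutativeRing commutativeRing
    using (setoid; refl; trans; +-cong; *-congˡ; +-identityˡ; *-identityʳ)
  open import Relation.Binary.Reasoning.Setoid setoid
  ω²≉1 : ¬ (ω * ω ≈ 1#)
  ω²≉1 ω²≈1 = ω-primitive 2 (s≤s z≤n) (s≤s (s≤s (s≤s z≤n)))
    (trans (*-congˡ (*-identityʳ ω)) ω²≈1)
  ω²²≈ω⁴ : (ω * ω) ^ 2 ≈ ω ^ 4
  ω²²≈ω⁴ = solve 1 (λ w → (w :* w) :* ((w :* w) :* :1) := w :* (w :* (w :* (w :* :1)))) refl ω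

ι-quadratic : ∀ {n} (K : CyclotomicField c ℓ₁ ℓ₂ (suc n)) → let open CyclotomicField K in
  ∀ p q r v {y} → y ≈ ι v →
  ι p + (ι q * y + ι r * (y * y)) ≈ ι (p ℚ.+ (q ℚ.* v ℚ.+ r ℚ.* (v ℚ.* v)))
ι-quadratic K p q r v {y} y≈v = begin
  ι p + (ι q * y + ι r * (y * y))            ≈⟨ +-congˡ (+-cong (*-congˡ y≈v) (*-congˡ (*-cong y≈v y≈v))) ⟩
  ι p + (ι q * ι v + ι r * (ι v * ι v))      ≈⟨ +-congˡ (+-cong (*-homo q v) (trans (*-homo r _) (*-congˡ (*-homo v v)))) ⟨
  ι p + (ι (q ℚ.* v) + ι (r ℚ.* (v ℚ.* v)))  ≈⟨ trans (+-homo p _) (+-congˡ (+-homo _ _)) ⟨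
  ι (p ℚ.+ (q ℚ.* v ℚ.+ r ℚ.* (v ℚ.* v)))    ∎
  where
  open CyclotomicField K
  open CommutativeRing commutativeRing using (setoid; trans; +-cong; +-congˡ; *-cong; *-congˡ)
  open IsRingMonomorphism ι-isMonomorphism using (+-homo; *-homo)
  open import Relation.Binary.Reasoning.Setoid setoid

-- Construction of the family with prescribed values.

module Interpolation (K : ∀ k → CyclotomicField c ℓ₁ ℓ₂ (2 ℕ.+ k)) (b : ℕ → ℚ) where

  -- F₂ = b₂ + linear · x₂ + quadratic · x₂² takes care of the levels 3 and 4,
  -- where α₂ is -1/2 and -1.  At level 4 nothing divisible by x₃ can
  -- contribute, since α₃ = 0.
  linear quadratic : ℚ
  linear    = b 4 ℚ.- b 2 ℚ.- fromℕ 4 ℚ.* (b 3 ℚ.- b 2)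
  quadratic = linear ℚ.+ (b 4 ℚ.- b 2)

  -- `step k` serves `F (suc k)`, which is evaluated at level k + 3; in the last clause this is
  -- level 5 + k, the field `K (3 ℕ.+ k)`.
  step : ∀ k → Polynomial (suc k) → Σ[ r ∈ Polynomial (2 ℕ.+ k) ] Exponents≤ 1 r
  -- `extend` multiplies these terms by x₂, which yields the linear and the quadratic term of F₂.
  step 0 _ = (linear , 0 ∷ 0 ∷ []) ∷ (quadratic , 0 ∷ 1 ∷ []) ∷ [] , z≤n ∷ s≤s z≤n ∷ []
  step 1 _ = [] , []
  step (suc (suc k)) p =
    let r , r≤1 , _ = LastVariable.solve-extension (K (3 ℕ.+ k)) (-ω²≉1 (K (3 ℕ.+ k))) p (b (5 ℕ.+ k))
    in r , r≤1

  F : ∀ k → Polynomial (suc k)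
  F zero    = (b 2 , 0 ∷ []) ∷ []
  F (suc k) = extend (F k) (proj₁ (step k (F k)))

  F≤2 : ∀ k → Exponents≤ 2 (F k)
  F≤2 zero    = z≤n ∷ []
  F≤2 (suc k) = Exponents≤-extend (F≤2 k) (proj₂ (step k (F k)))

  family : CompatibleFamily
  family = record { F = F ; compatible = λ k → extend-compatible (F k) _ }

  value : ∀ k → let open CyclotomicField (K k) in cosineValue (K k) family ≈ ι (b (2 ℕ.+ k))
  value 0 = begin
    ι (b 2) * (1# * 1#) + 0#   ≈⟨ +-identityʳ _ ⟩
    ι (b 2) * (1# * 1#)        ≈⟨ solve 1 (λ x → x :* (:1 :* :1) := x) refl _ ⟩
    ι (b 2)                    ∎
    where
    open CyclotomicField (K 0)
    open Cosines (K 0)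
    open CommutativeRing commutativeRing using (setoid; refl; +-identityʳ)
    open import Relation.Binary.Reasoning.Setoid setoid
  value 1 = begin
    cosineValue (K 1) family
      -- The left side is `evaluate` unfolded: exponents 0 leave factors `:1`, and `z` is the
      -- closing `0#`.
      ≈⟨ solve 5 (λ p q r y z →
           p :* (:1 :* (:1 :* :1)) :+ (q :* (:1 :* (y :* :1 :* :1)) :+ (r :* (:1 :* (y :* (y :* :1) :* :1)) :+ z))
           := (p :+ (q :* y :+ r :* (y :* y))) :+ z) refl (ι (b 2)) (ι linear) (ι quadratic) (point (suc zero)) 0# ⟩
    _ + 0#
      ≈⟨ +-identityʳ _ ⟩
    ι (b 2) + (ι linear * point (suc zero) + ι quadratic * (point (suc zero) * point (suc zero)))
      ≈⟨ ι-quadratic (K 1) (b 2) linear quadratic -½ (point-3 (K 1)) ⟩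
    ι (b 2 ℚ.+ (linear ℚ.* -½ ℚ.+ quadratic ℚ.* (-½ ℚ.* -½)))
      ≡⟨ ≡.cong ι b₃ ⟩
    ι (b 3) ∎
    where
    open CyclotomicField (K 1)
    open Cosines (K 1)
    open CommutativeRing commutativeRing using (setoid; refl; +-identityʳ)
    open import Relation.Binary.Reasoning.Setoid setoid
    -- The two coefficients l and q solve -l/2 + q/4 = b₃ - b₂ and -l + q = b₄ - b₂. This is the
    -- first equation; level 4 uses the second.
    b₃ : b 2 ℚ.+ (linear ℚ.* -½ ℚ.+ quadratic ℚ.* (-½ ℚ.* -½)) ≡ b 3
    b₃ = S.solve 3 (λ x y z →
      let l = z S.:- x S.:- S.con (fromℕ 4) S.:* (y S.:- x) in
      x S.:+ (l S.:* S.con -½ S.:+ (l S.:+ (z S.:- x)) S.:* (S.con -½ S.:* S.con -½)) S.:= y)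
      ≡.refl (b 2) (b 3) (b 4)
      where module S = ℚSolver.+-*-Solver
  -- `step 1` contributes no term, so this is again the quadratic F₂, now with α₂ = -1.
  value 2 = begin
    cosineValue (K 2) family
      ≈⟨ solve 5 (λ p q r y z →
           p :* (:1 :* (:1 :* (:1 :* :1)))
             :+ (q :* (:1 :* (y :* :1 :* (:1 :* :1))) :+ (r :* (:1 :* (y :* (y :* :1) :* (:1 :* :1))) :+ z))
           := (p :+ (q :* y :+ r :* (y :* y))) :+ z) refl (ι (b 2)) (ι linear) (ι quadratic) (point (suc zero)) 0# ⟩
    _ + 0#
      ≈⟨ +-identityʳ _ ⟩
    ι (b 2) + (ι linear * point (suc zero) + ι quadratic * (point (suc zero) * point (suc zero)))
      ≈⟨ ι-quadratic (K 2) (b 2) linear quadratic (ℚ.- 1ℚ) (point-4 (K 2)) ⟩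
    ι (b 2 ℚ.+ (linear ℚ.* (ℚ.- 1ℚ) ℚ.+ quadratic ℚ.* ((ℚ.- 1ℚ) ℚ.* (ℚ.- 1ℚ))))
      ≡⟨ ≡.cong ι b₄ ⟩
    ι (b 4) ∎
    where
    open CyclotomicField (K 2)
    open Cosines (K 2)
    open CommutativeRing commutativeRing using (setoid; refl; +-identityʳ)
    open import Relation.Binary.Reasoning.Setoid setoid
    b₄ : b 2 ℚ.+ (linear ℚ.* (ℚ.- 1ℚ) ℚ.+ quadratic ℚ.* ((ℚ.- 1ℚ) ℚ.* (ℚ.- 1ℚ))) ≡ b 4
    b₄ = S.solve 3 (λ x y z →
      let l = z S.:- x S.:- S.con (fromℕ 4) S.:* (y S.:- x)
          v = S.con (ℚ.- 1ℚ) in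
      x S.:+ (l S.:* v S.:+ (l S.:+ (z S.:- x)) S.:* (v S.:* v)) S.:= z)
      ≡.refl (b 2) (b 3) (b 4)
      where module S = ℚSolver.+-*-Solver
  -- `F (3 ℕ.+ k)` computes to the extension by the `r` of this same call, whose specification is
  -- the claim.
  value (suc (suc (suc k))) = proj₂ (proj₂
    (LastVariable.solve-extension (K (3 ℕ.+ k)) (-ω²≉1 (K (3 ℕ.+ k))) (F (2 ℕ.+ k)) (b (5 ℕ.+ k))))

-- Invariance without summability.

rational⇒GaloisFixed : ∀ {n} (K : CyclotomicField c ℓ₁ ℓ₂ n) → let open CyclotomicField K in
  ∀ {x} q → x ≈ ι q → GaloisFixed x
rational⇒GaloisFixed K q x≈q g = trans (⟦⟧-cong x≈q) (trans (fixesℚ q) (sym x≈q))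
  where
  open CyclotomicField K
  open GaloisAutomorphism g
  open IsRingIsomorphism isRingIsomorphism using (⟦⟧-cong)
  open CommutativeRing commutativeRing using (sym; trans)

parity-not-summable : (K : ∀ k → CyclotomicField c ℓ₁ ℓ₂ (2 ℕ.+ k)) →
  ¬ SummableAtCosinePoints K (Interpolation.family K parity)
parity-not-summable K (N , 2≤N , R , defined , agree) = parity-not-rational R N defined parity≡R
  where
  parity≡R : ∀ n (N≤n : N ≤ n) → parity n ≡ valueAt R n (defined n N≤n)
  -- From 2 ≤ N ≤ n the match writes n as 2 + k, the form in which levels are indexed; injectivity
  -- of `ι` then brings the agreement down to ℚ.
  parity≡R n N≤n with s≤s (s≤s (z≤n {k})) ← ℕ.≤-trans 2≤N N≤n =
    injective (trans (sym (Interpolation.value K parity k)) (agree k N≤n))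
    where
    open CyclotomicField (K k)
    open CommutativeRing commutativeRing using (sym; trans)
    open IsRingMonomorphism ι-isMonomorphism using (injective)

open import Data.Nat.Base using (_+_)

theorem2p6 : ∀ {c ℓ₁ ℓ₂ : Level} (K : ∀ k → CyclotomicField c ℓ₁ ℓ₂ (2 + k)) →
    (∀ (b : ℕ → ℚ) →
    Σ[ 𝓕 ∈ CompatibleFamily ]
    CompatibleFamily.AllDegrees≤ 𝓕 2
    × (∀ k → let open CyclotomicField (K k) using (_≈_) in
    cosineValue (K k) 𝓕 ≈ CyclotomicField.ι (K k) (b (2 + k))))
    ×
    (Σ[ 𝓕 ∈ CompatibleFamily ]
    (∃[ d ] CompatibleFamily.AllDegrees≤ 𝓕 d)
    × (∀ k → ValueLevelInvariant (K k) 𝓕)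
    × ¬ SummableAtCosinePoints K 𝓕)
theorem2p6 K =
  (λ b → let open Interpolation K b in
     family , (λ k → Exponents≤⇒TotalDegree≤ (F≤2 k)) , value)
  , (let open Interpolation K parity in
     family
     , (2 , λ k → Exponents≤⇒TotalDegree≤ (F≤2 k))
     , (λ k → rational⇒GaloisFixed (K k) (parity (2 + k)) (value k))
     , parity-not-summable K)
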